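{- Let $p/q$ be a rational number in lowest terms, let $m\ge 0$ be an integer, and let $(u_n)_{n\ge1}$ be an arbitrary sequence of positive integers. Write $p/q=[a_0;a_1,\dots,a_{2k}]$ as a finite continued fraction whose last partial quotient has even index $2k$, and let $q_{2k-1}$ be the denominator of its $(2k-1)$th convergent. Suppose $x_1=q>1$, and let $\alpha$ be given by the series $$\alpha=\frac pq+\sum_{j=2}^\infty\frac{(-1)^j}{x_j},$$ where $(x_n)_{n\ge1}$, together with $(y_n)_{n\ge0}$, is defined by $$y_j=y_{j-1}(1+u_jx_j),\qquad x_{j+1}=x_jy_j,\qquad j\ge 1,$$ with $$x_1=q,\qquad y_0=mq+q_{2k-1}-1,$$ and where the restriction $m\ge1$ is imposed if $q_{2k-1}=1$. Then the continued fraction expansion of $\alpha$ has the form $\alpha=[a_0;a_1,a_2,\dots]$, where the partial quotients $a_j$ coincide with those of $p/q=[a_0;a_1,\dots,a_{2k}]$ for $0\le j\le 2k$, while $$a_{2k+1}=m+u_1y_0-1,$$ and $$a_{2k+3j-1}=1,\qquad a_{2k+3j}=x_j-1,\qquad a_{2k+3j+1}=u_{j+1}y_j-1\qquad\text{for all } j\ge 1.$$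
   Context: Continued fractions: $[a_0;a_1,\dots,a_n]=a_0+\cfrac{1}{a_1+\cfrac{1}{\cdots+\cfrac1{a_n}}}=p_n/q_n$ with $a_0\in\mathbb Z$, $a_j\in\mathbb Z_{>0}$ for $j\ge1$, and $p_n/q_n$ in lowest terms with $q_n>0$; an infinite continued fraction is $[a_0;a_1,a_2,\dots]=\lim_{n\to\infty}[a_0;a_1,\dots,a_n]$. The numerators and denominators of the convergents $p_n/q_n$ satisfy $p_{n+1}=a_{n+1}p_n+p_{n-1}$, $q_{n+1}=a_{n+1}q_n+q_{n-1}$ for $n\ge -1$, with $p_{ -1}=1$, $p_{ -2}=0$, $q_{ -1}=0$, $q_{ -2}=1$. Every rational number has a finite continued fraction whose last index is even, because $[a_0;\dots,a_j]=[a_0;\dots,a_j-1,1]$ if $j=0$ or $a_j>1$, and $[a_0;\dots,a_{j-1},1]=[a_0;\dots,a_{j-1}+1]$.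
   Formalization: When m=0, u_1=1 and q_{2k-1}=2 (e.g. p/q=1/3=[0;2,1]) the stated formula gives a_{2k+1}=0, not a valid partial quotient; positivity of the a_j is therefore claimed only outside this case, while the formulas and the limit are claimed in all cases. -}

module Defs where

open import Data.Nat.Base as ℕ using (ℕ; zero; suc)
open import Data.Integer.Base as ℤ using (ℤ; +_; +0; +[1+_]; -[1+_]; 0ℤ; 1ℤ; -1ℤ)
open import Data.Rational.Base using (ℚ; mkℚ; 0ℚ; _+_; _-_; _*_; _/_; 1/_; _<_; ∣_∣; ↧ₙ_)
open import Data.Product.Base using (∃-syntax)
open import Function.Base using (_∘_)

infix 9 _⁻¹

-- Total reciprocal, with the junk value 0 ⁻¹ = 0.
_⁻¹ : ℚ → ℚ
(mkℚ +0         _ _) ⁻¹ = 0ℚ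
r@(mkℚ +[1+ _ ] _ _) ⁻¹ = 1/ r
r@(mkℚ -[1+ _ ] _ _) ⁻¹ = 1/ r

-- [ a ⨾ n ] is the finite continued fraction [a₀; a₁, …, aₙ]; it depends
-- only on the entries a₀, …, aₙ of the sequence.  No division by zero
-- occurs when a₁, …, aₙ are positive.
[_⨾_] : (ℕ → ℤ) → ℕ → ℚ
[ a ⨾ zero  ] = a 0 / 1
[ a ⨾ suc n ] = a 0 / 1 + [ a ∘ suc ⨾ n ] ⁻¹

-- q[ a , n -1] is q₍ₙ₋₁₎, the denominator in lowest terms of the convergent
-- of index n - 1, with the usual convention q₋₁ = 0.
q[_,_-1] : (ℕ → ℤ) → ℕ → ℕ
q[ a , zero  -1] = 0
q[ a , suc n -1] = ↧ₙ [ a ⨾ n ]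

-- ∑[ f from i ] n = f i + f (i + 1) + ⋯ + f (i + n - 1).
∑[_from_] : (ℕ → ℚ) → ℕ → ℕ → ℚ
∑[ f from i ] zero    = 0ℚ
∑[ f from i ] (suc n) = ∑[ f from i ] n + f (i ℕ.+ n)

-- Partial sums of r + ∑_{j ≥ 2} (-1)ʲ / xⱼ.
partialSum : ℚ → (ℕ → ℕ) → ℕ → ℚ
partialSum r x n = r + ∑[ (λ j → ((-1ℤ ℤ.^ j) / 1) * ((+ x j) / 1) ⁻¹) from 2 ] n

-- Real numbers, represented by Cauchy sequences of rationals.  Different
-- sequences may represent the same real; the theorem mentions reals only
-- through _⟶_, which does not depend on the representative.
record ℝ : Set where
  field
    seq    : ℕ → ℚ
    cauchy : ∀ ε → 0ℚ < ε → ∃[ N ] (∀ i j → N ℕ.≤ i → N ℕ.≤ j → ∣ seq i - seq j ∣ < ε)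

infix 4 _⟶_

-- The rational sequence s converges to the real α.  Since seq α is itself
-- Cauchy with limit α, this is the usual "∣ s i - α ∣ is eventually
-- smaller than any given ε".
_⟶_ : (ℕ → ℚ) → ℝ → Set
s ⟶ α = ∀ ε → 0ℚ < ε → ∃[ N ] (∀ i j → N ℕ.≤ i → N ℕ.≤ j → ∣ s i - ℝ.seq α j ∣ < ε)

{-# OPTIONS --safe #-}
-- Let pₙ / qₙ be the convergents of the claimed expansion.  The recurrence for
-- the denominators, together with the recursions for x and y, gives
--   q_{2k+3j} = x_{j+1},  q_{2k+3j+1} = y_{j+1} - x_{j+1} + 1,  q_{2k+3j+2} = y_{j+1} + 1,
-- and the determinant formula gives
--   p_{n+3} / q_{n+3} - p_n / q_n = (-1)ⁿ (a_{n+2} a_{n+3} + 1) / (q_n q_{n+3}),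
-- which for n = 2k + 3j is (-1)ʲ / x_{j+2}.  So every third convergent is a
-- partial sum of the series, and the two convergents after it are at distance
-- at most 1 / x_{j+1} from it.  Since x at least doubles at each step, the
-- increments 1 / x_{j+2} are bounded by 1 / x_{j+1} - 1 / x_{j+2}, which telescopes.
module Submission where

open import Defs
open import Data.Nat.Base as ℕ using (ℕ; zero; suc; _+_; _*_; _∸_; _≤_; _<_; NonZero; z≤n; s≤s)
open import Data.Nat.Coprimality using (Coprime)
open import Data.Integer.Base as ℤ using (ℤ; +_; 0ℤ; 1ℤ; -1ℤ; ∣_∣)
open import Data.Rational.Base as ℚ using (ℚ; mkℚ; 0ℚ; 1ℚ; ½; _/_; ↧ₙ_)
open import Data.Product.Base using (_×_; _,_; proj₁; proj₂; ∃-syntax)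
open import Data.Sum.Base using (_⊎_; inj₁; inj₂)
open import Function.Base using (_∘_)
open import Relation.Nullary.Negation.Core using (¬_; contradiction)
open import Relation.Nullary.Decidable.Core using (decidable-stable)
open import Relation.Binary.PropositionalEquality
import Data.Nat.Properties as ℕ
import Data.Nat.Coprimality as Coprime
import Data.Nat.Divisibility as ℕ
import Data.Integer.Properties as ℤ
import Data.Integer.GCD as ℤ
import Data.Integer.Divisibility.Signed as ℤ
open import Data.Nat.Tactic.RingSolver using () renaming (solve-∀ to ℕ-solve-∀)
open import Data.Integer.Tactic.RingSolver using (solve-∀)
import Data.Rational.Properties as ℚ
open import Data.Rational.Solver using (module +-*-Solver)
open +-*-Solver using (_:+_; _:*_; _:-_; :-_; _:=_) renaming (solve to ℚ-solve)
import Data.Rational.Unnormalised.Base as ℚᵘ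
import Data.Rational.Unnormalised.Properties as ℚᵘ

-- Rational numbers

ι : ℤ → ℚ
ι i = i / 1

-- Normalisation to lowest terms hides the arithmetic, so the identity is checked on unnormalised
-- rationals, where it is one equation between integers.
ι-+ : ∀ i j → ι (i ℤ.+ j) ≡ ι i ℚ.+ ι j
ι-+ i j = ℚ.toℚᵘ-injective (begin
  ℚ.toℚᵘ (ι (i ℤ.+ j))                ≈⟨ ℚ.toℚᵘ-fromℚᵘ (ℚᵘ.mkℚᵘ (i ℤ.+ j) 0) ⟩
  ℚᵘ.mkℚᵘ (i ℤ.+ j) 0                 ≈⟨ ℚᵘ.*≡* (identity i j) ⟩
  ℚᵘ.mkℚᵘ i 0 ℚᵘ.+ ℚᵘ.mkℚᵘ j 0        ≈⟨ ℚᵘ.+-cong (ℚ.toℚᵘ-fromℚᵘ (ℚᵘ.mkℚᵘ i 0)) (ℚ.toℚᵘ-fromℚᵘ (ℚᵘ.mkℚᵘ j 0)) ⟨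
  ℚ.toℚᵘ (ι i) ℚᵘ.+ ℚ.toℚᵘ (ι j)      ≈⟨ ℚ.toℚᵘ-homo-+ (ι i) (ι j) ⟨
  ℚ.toℚᵘ (ι i ℚ.+ ι j)                ∎)
  where
  open ℚᵘ.≃-Reasoning
  identity : ∀ i j → (i ℤ.+ j) ℤ.* 1ℤ ≡ (i ℤ.* 1ℤ ℤ.+ j ℤ.* 1ℤ) ℤ.* 1ℤ
  identity = solve-∀

/-*ι : ∀ i j n .{{_ : NonZero n}} → i / n ℚ.* ι j ≡ (i ℤ.* j) / n
/-*ι i j n@(suc n-1) = ℚ.toℚᵘ-injective (begin
  ℚ.toℚᵘ (i / n ℚ.* ι j)              ≈⟨ ℚ.toℚᵘ-homo-* (i / n) (ι j) ⟩
  ℚ.toℚᵘ (i / n) ℚᵘ.* ℚ.toℚᵘ (ι j)    ≈⟨ ℚᵘ.*-cong (ℚ.toℚᵘ-fromℚᵘ (ℚᵘ.mkℚᵘ i n-1)) (ℚ.toℚᵘ-fromℚᵘ (ℚᵘ.mkℚᵘ j 0)) ⟩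
  ℚᵘ.mkℚᵘ i n-1 ℚᵘ.* ℚᵘ.mkℚᵘ j 0      ≈⟨ ℚᵘ.*≡* (cong ((i ℤ.* j) ℤ.*_) (cong +_ (sym (ℕ.*-identityʳ n)))) ⟩
  ℚᵘ.mkℚᵘ (i ℤ.* j) n-1               ≈⟨ ℚ.toℚᵘ-fromℚᵘ (ℚᵘ.mkℚᵘ (i ℤ.* j) n-1) ⟨
  ℚ.toℚᵘ ((i ℤ.* j) / n)              ∎)
  where open ℚᵘ.≃-Reasoning

ι-* : ∀ i j → ι (i ℤ.* j) ≡ ι i ℚ.* ι j
ι-* i j = sym (/-*ι i j 1)

ι-neg : ∀ i → ι (ℤ.- i) ≡ ℚ.- ι i
ι-neg i = ℚ.toℚᵘ-injective (begin
  ℚ.toℚᵘ (ι (ℤ.- i))                  ≈⟨ ℚ.toℚᵘ-fromℚᵘ (ℚᵘ.mkℚᵘ (ℤ.- i) 0) ⟩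
  ℚᵘ.- ℚᵘ.mkℚᵘ i 0                    ≈⟨ ℚᵘ.-‿cong (ℚ.toℚᵘ-fromℚᵘ (ℚᵘ.mkℚᵘ i 0)) ⟨
  ℚᵘ.- ℚ.toℚᵘ (ι i)                   ≈⟨ ℚ.toℚᵘ-homo‿- (ι i) ⟨
  ℚ.toℚᵘ (ℚ.- ι i)                    ∎)
  where open ℚᵘ.≃-Reasoning

ι-- : ∀ i j → ι (i ℤ.- j) ≡ ι i ℚ.- ι j
ι-- i j = trans (ι-+ i (ℤ.- j)) (cong (ι i ℚ.+_) (ι-neg j))

ι-mono-≤ : ∀ {i j} → i ℤ.≤ j → ι i ℚ.≤ ι j
ι-mono-≤ {i} {j} i≤j = ℚ.toℚᵘ-cancel-≤ (begin
  ℚ.toℚᵘ (ι i)   ≃⟨ ℚ.toℚᵘ-fromℚᵘ (ℚᵘ.mkℚᵘ i 0) ⟩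
  ℚᵘ.mkℚᵘ i 0    ≤⟨ ℚᵘ.*≤* (ℤ.*-monoʳ-≤-nonNeg 1ℤ i≤j) ⟩
  ℚᵘ.mkℚᵘ j 0    ≃⟨ ℚ.toℚᵘ-fromℚᵘ (ℚᵘ.mkℚᵘ j 0) ⟨
  ℚ.toℚᵘ (ι j)   ∎)
  where open ℚᵘ.≤-Reasoning

ι-mono-< : ∀ {i j} → i ℤ.< j → ι i ℚ.< ι j
ι-mono-< {i} {j} i<j = ℚ.toℚᵘ-cancel-< (begin-strict
  ℚ.toℚᵘ (ι i)   ≃⟨ ℚ.toℚᵘ-fromℚᵘ (ℚᵘ.mkℚᵘ i 0) ⟩
  ℚᵘ.mkℚᵘ i 0    <⟨ ℚᵘ.*<* (ℤ.*-monoʳ-<-pos 1ℤ i<j) ⟩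
  ℚᵘ.mkℚᵘ j 0    ≃⟨ ℚ.toℚᵘ-fromℚᵘ (ℚᵘ.mkℚᵘ j 0) ⟨
  ℚ.toℚᵘ (ι j)   ∎)
  where open ℚᵘ.≤-Reasoning

⁻¹-inverseʳ : ∀ r → 0ℚ ℚ.< r → r ℚ.* r ⁻¹ ≡ 1ℚ
⁻¹-inverseʳ (mkℚ (ℤ.+ zero) _ _)    (ℚ.*<* (ℤ.+<+ ()))
⁻¹-inverseʳ r@(mkℚ ℤ.+[1+ _ ] _ _)  _ = ℚ.*-inverseʳ r
⁻¹-inverseʳ (mkℚ ℤ.-[1+ _ ] _ _)    (ℚ.*<* ())

⁻¹-unique : ∀ r s → 0ℚ ℚ.< r → r ℚ.* s ≡ 1ℚ → r ⁻¹ ≡ s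
⁻¹-unique r s 0<r rs≡1 = begin
  r ⁻¹                ≡⟨ ℚ.*-identityʳ (r ⁻¹) ⟨
  r ⁻¹ ℚ.* 1ℚ         ≡⟨ cong (r ⁻¹ ℚ.*_) rs≡1 ⟨
  r ⁻¹ ℚ.* (r ℚ.* s)  ≡⟨ ℚ-solve 3 (λ r r⁻¹ s → r⁻¹ :* (r :* s) := (r :* r⁻¹) :* s) refl r (r ⁻¹) s ⟩
  (r ℚ.* r ⁻¹) ℚ.* s  ≡⟨ cong (ℚ._* s) (⁻¹-inverseʳ r 0<r) ⟩
  1ℚ ℚ.* s            ≡⟨ ℚ.*-identityˡ s ⟩
  s                   ∎
  where open ≡-Reasoning

⁻¹-pos : ∀ r → 0ℚ ℚ.< r → 0ℚ ℚ.< r ⁻¹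
⁻¹-pos (mkℚ (ℤ.+ zero) _ _)   (ℚ.*<* (ℤ.+<+ ()))
⁻¹-pos (mkℚ ℤ.+[1+ n ] d c)   _ = ℚ.positive⁻¹ (mkℚ ℤ.+[1+ n ] d c ⁻¹)
⁻¹-pos (mkℚ ℤ.-[1+ _ ] _ _)   (ℚ.*<* ())

-- The denominator is an integer so that continuants fit in directly; its positivity is supplied to
-- each lemma as a proof.
frac : ℤ → ℤ → ℚ
frac p q = ι p ℚ.* ι q ⁻¹

ι-inverseʳ : ∀ {q} → 0ℤ ℤ.< q → ι q ℚ.* ι q ⁻¹ ≡ 1ℚ
ι-inverseʳ {q} 0<q = ⁻¹-inverseʳ (ι q) (ι-mono-< 0<q)

ι⁻¹-pos : ∀ {q} → 0ℤ ℤ.< q → 0ℚ ℚ.< ι q ⁻¹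
ι⁻¹-pos {q} 0<q = ⁻¹-pos (ι q) (ι-mono-< 0<q)

frac-unique : ∀ r p q → 0ℤ ℤ.< q → r ℚ.* ι q ≡ ι p → r ≡ frac p q
frac-unique r p q 0<q rq≡p = begin
  r                         ≡⟨ ℚ.*-identityʳ r ⟨
  r ℚ.* 1ℚ                  ≡⟨ cong (r ℚ.*_) (ι-inverseʳ 0<q) ⟨
  r ℚ.* (ι q ℚ.* ι q ⁻¹)    ≡⟨ ℚ.*-assoc r (ι q) (ι q ⁻¹) ⟨
  r ℚ.* ι q ℚ.* ι q ⁻¹      ≡⟨ cong (ℚ._* ι q ⁻¹) rq≡p ⟩
  frac p q                  ∎
  where open ≡-Reasoning

frac-cancel : ∀ p {q} → 0ℤ ℤ.< q → frac p q ℚ.* ι q ≡ ι p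
frac-cancel p {q} 0<q = begin
  ι p ℚ.* ι q ⁻¹ ℚ.* ι q    ≡⟨ ℚ-solve 3 (λ p q i → p :* i :* q := p :* (q :* i)) refl (ι p) (ι q) (ι q ⁻¹) ⟩
  ι p ℚ.* (ι q ℚ.* ι q ⁻¹)  ≡⟨ cong (ι p ℚ.*_) (ι-inverseʳ 0<q) ⟩
  ι p ℚ.* 1ℚ                ≡⟨ ℚ.*-identityʳ (ι p) ⟩
  ι p                       ∎
  where open ≡-Reasoning

/≡frac : ∀ p q .{{_ : NonZero q}} → p / q ≡ frac p (+ q)
/≡frac p q@(suc q-1) = frac-unique (p / q) p (+ q) (ℤ.+<+ (s≤s z≤n)) (begin
  p / q ℚ.* ι (+ q)    ≡⟨ /-*ι p (+ q) q ⟩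
  (p ℤ.* + q) / q      ≡⟨ ℚ.fromℚᵘ-cong {ℚᵘ.mkℚᵘ (p ℤ.* + q) q-1} {ℚᵘ.mkℚᵘ p 0} (ℚᵘ.*≡* (ℤ.*-identityʳ _)) ⟩
  ι p                  ∎)
  where open ≡-Reasoning

frac-⁻¹ : ∀ {p q} → 0ℤ ℤ.< p → 0ℤ ℤ.< q → frac p q ⁻¹ ≡ frac q p
frac-⁻¹ {p} {q} 0<p 0<q = ⁻¹-unique (frac p q) (frac q p) 0<frac (begin
  ι p ℚ.* ι q ⁻¹ ℚ.* (ι q ℚ.* ι p ⁻¹)    ≡⟨ ℚ-solve 4 (λ p p⁻¹ q q⁻¹ → p :* q⁻¹ :* (q :* p⁻¹) := p :* p⁻¹ :* (q :* q⁻¹)) refl (ι p) (ι p ⁻¹) (ι q) (ι q ⁻¹) ⟩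
  ι p ℚ.* ι p ⁻¹ ℚ.* (ι q ℚ.* ι q ⁻¹)    ≡⟨ cong₂ ℚ._*_ (ι-inverseʳ 0<p) (ι-inverseʳ 0<q) ⟩
  1ℚ                                     ∎)
  where
  open ≡-Reasoning
  0<frac : 0ℚ ℚ.< frac p q
  0<frac = ℚ.positive⁻¹ _ {{ℚ.pos*pos⇒pos (ι p) {{ℚ.positive (ι-mono-< 0<p)}} (ι q ⁻¹) {{ℚ.positive (ι⁻¹-pos 0<q)}}}}

frac-difference : ∀ p q p′ q′ {e} → 0ℤ ℤ.< q → 0ℤ ℤ.< q′ → p′ ℤ.* q ℤ.- p ℤ.* q′ ≡ e →
                  frac p′ q′ ℚ.- frac p q ≡ ι e ℚ.* (ι q ⁻¹ ℚ.* ι q′ ⁻¹)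
frac-difference p q p′ q′ {e} 0<q 0<q′ det = begin
  ι p′ ℚ.* ι q′ ⁻¹ ℚ.- ι p ℚ.* ι q ⁻¹
    ≡⟨ cong₂ ℚ._-_ (ℚ.*-identityʳ (frac p′ q′)) (ℚ.*-identityʳ (frac p q)) ⟨
  ι p′ ℚ.* ι q′ ⁻¹ ℚ.* 1ℚ ℚ.- ι p ℚ.* ι q ⁻¹ ℚ.* 1ℚ
    ≡⟨ cong₂ (λ r s → ι p′ ℚ.* ι q′ ⁻¹ ℚ.* r ℚ.- ι p ℚ.* ι q ⁻¹ ℚ.* s) (ι-inverseʳ 0<q) (ι-inverseʳ 0<q′) ⟨
  ι p′ ℚ.* ι q′ ⁻¹ ℚ.* (ι q ℚ.* ι q ⁻¹) ℚ.- ι p ℚ.* ι q ⁻¹ ℚ.* (ι q′ ℚ.* ι q′ ⁻¹)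
    ≡⟨ ℚ-solve 6 (λ p q i p′ q′ i′ → p′ :* i′ :* (q :* i) :- p :* i :* (q′ :* i′) := (p′ :* q :- p :* q′) :* (i :* i′)) refl
         (ι p) (ι q) (ι q ⁻¹) (ι p′) (ι q′) (ι q′ ⁻¹) ⟩
  (ι p′ ℚ.* ι q ℚ.- ι p ℚ.* ι q′) ℚ.* (ι q ⁻¹ ℚ.* ι q′ ⁻¹)
    ≡⟨ cong (ℚ._* (ι q ⁻¹ ℚ.* ι q′ ⁻¹)) (cong₂ ℚ._-_ (ι-* p′ q) (ι-* p q′)) ⟨
  (ι (p′ ℤ.* q) ℚ.- ι (p ℤ.* q′)) ℚ.* (ι q ⁻¹ ℚ.* ι q′ ⁻¹)
    ≡⟨ cong (ℚ._* (ι q ⁻¹ ℚ.* ι q′ ⁻¹)) (trans (sym (ι-- (p′ ℤ.* q) (p ℤ.* q′))) (cong ι det)) ⟩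
  ι e ℚ.* (ι q ⁻¹ ℚ.* ι q′ ⁻¹)
    ∎
  where open ≡-Reasoning

-1^n≡±1 : ∀ n → -1ℤ ℤ.^ n ≡ 1ℤ ⊎ -1ℤ ℤ.^ n ≡ -1ℤ
-1^n≡±1 zero    = inj₁ refl
-1^n≡±1 (suc n) with -1^n≡±1 n
... | inj₁ eq = inj₂ (cong (-1ℤ ℤ.*_) eq)
... | inj₂ eq = inj₁ (cong (-1ℤ ℤ.*_) eq)

∣±r∣≡r : ∀ n r → 0ℚ ℚ.≤ r → ℚ.∣ ι (-1ℤ ℤ.^ n) ℚ.* r ∣ ≡ r
∣±r∣≡r n r 0≤r = begin
  ℚ.∣ ι (-1ℤ ℤ.^ n) ℚ.* r ∣            ≡⟨ ℚ.∣p*q∣≡∣p∣*∣q∣ (ι (-1ℤ ℤ.^ n)) r ⟩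
  ℚ.∣ ι (-1ℤ ℤ.^ n) ∣ ℚ.* ℚ.∣ r ∣      ≡⟨ cong₂ ℚ._*_ (∣±1∣ (-1^n≡±1 n)) (ℚ.0≤p⇒∣p∣≡p 0≤r) ⟩
  1ℚ ℚ.* r                             ≡⟨ ℚ.*-identityˡ r ⟩
  r                                    ∎
  where
  open ≡-Reasoning
  ∣±1∣ : ∀ {i} → i ≡ 1ℤ ⊎ i ≡ -1ℤ → ℚ.∣ ι i ∣ ≡ 1ℚ
  ∣±1∣ (inj₁ refl) = refl
  ∣±1∣ (inj₂ refl) = refl

-- Up to sign the difference is 1 / (q q′), and a positive integer q′ is at least 1.
frac-close : ∀ n p q p′ q′ → 0ℤ ℤ.< q → 0ℤ ℤ.< q′ → p′ ℤ.* q ℤ.- p ℤ.* q′ ≡ -1ℤ ℤ.^ n →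
             ℚ.∣ frac p′ q′ ℚ.- frac p q ∣ ℚ.≤ ι q ⁻¹
frac-close n p q p′ q′ 0<q 0<q′ det = begin
  ℚ.∣ frac p′ q′ ℚ.- frac p q ∣                           ≡⟨ cong ℚ.∣_∣ (frac-difference p q p′ q′ 0<q 0<q′ det) ⟩
  ℚ.∣ ι (-1ℤ ℤ.^ n) ℚ.* (ι q ⁻¹ ℚ.* ι q′ ⁻¹) ∣            ≡⟨ ∣±r∣≡r n _ (ℚ.nonNegative⁻¹ _ {{ℚ.nonNeg*nonNeg⇒nonNeg (ι q ⁻¹) (ι q′ ⁻¹)}}) ⟩
  ι q ⁻¹ ℚ.* ι q′ ⁻¹                                      ≡⟨ ℚ.*-identityʳ _ ⟨
  ι q ⁻¹ ℚ.* ι q′ ⁻¹ ℚ.* 1ℚ                               ≤⟨ ℚ.*-monoˡ-≤-nonNeg (ι q ⁻¹ ℚ.* ι q′ ⁻¹) {{ℚ.nonNeg*nonNeg⇒nonNeg (ι q ⁻¹) (ι q′ ⁻¹)}} (ι-mono-≤ (ℤ.i<j⇒suc[i]≤j 0<q′)) ⟩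
  ι q ⁻¹ ℚ.* ι q′ ⁻¹ ℚ.* ι q′                             ≡⟨ frac-cancel′ ⟩
  ι q ⁻¹                                                  ∎
  where
  open ℚ.≤-Reasoning
  instance
    nonNeg-q  = ℚ.pos⇒nonNeg (ι q ⁻¹) {{ℚ.positive (ι⁻¹-pos 0<q)}}
    nonNeg-q′ = ℚ.pos⇒nonNeg (ι q′ ⁻¹) {{ℚ.positive (ι⁻¹-pos 0<q′)}}
  frac-cancel′ : ι q ⁻¹ ℚ.* ι q′ ⁻¹ ℚ.* ι q′ ≡ ι q ⁻¹
  frac-cancel′ = trans (ℚ.*-assoc (ι q ⁻¹) (ι q′ ⁻¹) (ι q′)) (trans (cong (ι q ⁻¹ ℚ.*_) (trans (ℚ.*-comm (ι q′ ⁻¹) (ι q′)) (ι-inverseʳ 0<q′))) (ℚ.*-identityʳ _))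

frac-lowest-terms : ∀ p q .{{_ : NonZero q}} → Coprime ∣ p ∣ q → ↧ₙ (p / q) ≡ q
frac-lowest-terms p q coprime = ℤ.+-injective (begin
  ℚ.↧ (p / q)                         ≡⟨ ℤ.*-identityʳ _ ⟨
  ℚ.↧ (p / q) ℤ.* 1ℤ                  ≡⟨ cong (λ d → ℚ.↧ (p / q) ℤ.* + d) (Coprime.coprime⇒gcd≡1 coprime) ⟨
  ℚ.↧ (p / q) ℤ.* ℤ.gcd p (+ q)       ≡⟨ ℚ.↧-/ p q ⟩
  + q                                 ∎)
  where open ≡-Reasoning

-- Continuants and convergents

*-nonNeg : ∀ {i j} → 0ℤ ℤ.≤ i → 0ℤ ℤ.≤ j → 0ℤ ℤ.≤ i ℤ.* j
*-nonNeg {+ i} {+ j} _ _ = subst (0ℤ ℤ.≤_) (ℤ.pos-* i j) (ℤ.+≤+ z≤n)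

-- The continuants pₙ and qₙ. They recurse at the head, as `[_⨾_]` does; the usual recurrence at the
-- last entry is derived from this.
num den : (ℕ → ℤ) → ℕ → ℤ
num a zero    = a 0
num a (suc n) = a 0 ℤ.* num (a ∘ suc) n ℤ.+ den (a ∘ suc) n
den a zero    = 1ℤ
den a (suc n) = num (a ∘ suc) n

-- Prepending an entry acts linearly on the pair (`num`, `den`) of the tail, so a recurrence
-- satisfied by both tails is inherited. The induction goes down two steps because `den` of a tail
-- is `num` of the tail after it.
num-recurrence : ∀ a n → num a (2 + n) ≡ a (2 + n) ℤ.* num a (1 + n) ℤ.+ num a n
num-recurrence a zero = identity (a 0) (a 1) (a 2)
  where
  identity : ∀ a b c → a ℤ.* (b ℤ.* c ℤ.+ 1ℤ) ℤ.+ c ≡ c ℤ.* (a ℤ.* b ℤ.+ 1ℤ) ℤ.+ a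
  identity = solve-∀
num-recurrence a (suc zero) =
  trans (cong (λ i → a 0 ℤ.* i ℤ.+ num (a ∘ suc ∘ suc) 1) (num-recurrence (a ∘ suc) 0))
        (identity (a 0) (a 1) (a 2) (a 3))
  where
  identity : ∀ a b c d → a ℤ.* (d ℤ.* (b ℤ.* c ℤ.+ 1ℤ) ℤ.+ b) ℤ.+ (c ℤ.* d ℤ.+ 1ℤ) ≡
                         d ℤ.* (a ℤ.* (b ℤ.* c ℤ.+ 1ℤ) ℤ.+ c) ℤ.+ (a ℤ.* b ℤ.+ 1ℤ)
  identity = solve-∀
num-recurrence a (suc (suc n)) =
  trans (cong₂ (λ i j → a 0 ℤ.* i ℤ.+ j) (num-recurrence (a ∘ suc) (suc n)) (num-recurrence (a ∘ suc ∘ suc) n))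
        (identity (a 0) (a (4 + n)) _ _ _ _)
  where
  identity : ∀ a b p p′ q q′ → a ℤ.* (b ℤ.* p ℤ.+ p′) ℤ.+ (b ℤ.* q ℤ.+ q′) ≡
                               b ℤ.* (a ℤ.* p ℤ.+ q) ℤ.+ (a ℤ.* p′ ℤ.+ q′)
  identity = solve-∀

den-recurrence : ∀ a n → den a (2 + n) ≡ a (2 + n) ℤ.* den a (1 + n) ℤ.+ den a n
den-recurrence a zero    = cong (ℤ._+ 1ℤ) (ℤ.*-comm (a 1) (a 2))
den-recurrence a (suc n) = num-recurrence (a ∘ suc) n

-- Prepending an entry multiplies by a matrix of determinant -1.
determinant₁ : ∀ a n → num a (1 + n) ℤ.* den a n ℤ.- num a n ℤ.* den a (1 + n) ≡ -1ℤ ℤ.^ n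
determinant₁ a zero = identity (a 0) (a 1)
  where
  identity : ∀ a b → (a ℤ.* b ℤ.+ 1ℤ) ℤ.* 1ℤ ℤ.- a ℤ.* b ≡ 1ℤ
  identity = solve-∀
determinant₁ a (suc n) =
  trans (identity (a 0) (num a′ (suc n)) (den a′ (suc n)) (num a′ n) (den a′ n)) (cong (-1ℤ ℤ.*_) (determinant₁ a′ n))
  where
  a′ = a ∘ suc
  identity : ∀ a p q p′ q′ → (a ℤ.* p ℤ.+ q) ℤ.* p′ ℤ.- (a ℤ.* p′ ℤ.+ q′) ℤ.* p ≡ -1ℤ ℤ.* (p ℤ.* q′ ℤ.- p′ ℤ.* q)
  identity = solve-∀

determinant₂ : ∀ a n → num a (2 + n) ℤ.* den a n ℤ.- num a n ℤ.* den a (2 + n) ≡ a (2 + n) ℤ.* -1ℤ ℤ.^ n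
determinant₂ a n = begin
  num a (2 + n) ℤ.* den a n ℤ.- num a n ℤ.* den a (2 + n)
    ≡⟨ cong₂ (λ p q → p ℤ.* den a n ℤ.- num a n ℤ.* q) (num-recurrence a n) (den-recurrence a n) ⟩
  _ ≡⟨ identity (a (2 + n)) (num a (1 + n)) (den a (1 + n)) (num a n) (den a n) ⟩
  a (2 + n) ℤ.* (num a (1 + n) ℤ.* den a n ℤ.- num a n ℤ.* den a (1 + n))
    ≡⟨ cong (a (2 + n) ℤ.*_) (determinant₁ a n) ⟩
  a (2 + n) ℤ.* -1ℤ ℤ.^ n
    ∎
  where
  open ≡-Reasoning
  identity : ∀ a p q p′ q′ → (a ℤ.* p ℤ.+ p′) ℤ.* q′ ℤ.- p′ ℤ.* (a ℤ.* q ℤ.+ q′) ≡ a ℤ.* (p ℤ.* q′ ℤ.- p′ ℤ.* q)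
  identity = solve-∀

-- Expanding the last convergent by its recurrence leaves a combination of the two shorter
-- determinants. In the expansion of α the last factor becomes (x - 1) * 1 + 1 = x.
determinant₃ : ∀ a n → num a (3 + n) ℤ.* den a n ℤ.- num a n ℤ.* den a (3 + n) ≡
                       -1ℤ ℤ.^ n ℤ.* (a (3 + n) ℤ.* a (2 + n) ℤ.+ 1ℤ)
determinant₃ a n = begin
  num a (3 + n) ℤ.* den a n ℤ.- num a n ℤ.* den a (3 + n)
    ≡⟨ cong₂ (λ p q → p ℤ.* den a n ℤ.- num a n ℤ.* q) (num-recurrence a (suc n)) (den-recurrence a (suc n)) ⟩
  _ ≡⟨ identity (a (3 + n)) (num a (2 + n)) (den a (2 + n)) (num a (1 + n)) (den a (1 + n)) (num a n) (den a n) ⟩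
  _ ≡⟨ cong₂ (λ d e → a (3 + n) ℤ.* d ℤ.+ e) (determinant₂ a n) (determinant₁ a n) ⟩
  _ ≡⟨ identity′ (a (3 + n)) (a (2 + n)) (-1ℤ ℤ.^ n) ⟩
  -1ℤ ℤ.^ n ℤ.* (a (3 + n) ℤ.* a (2 + n) ℤ.+ 1ℤ)
    ∎
  where
  open ≡-Reasoning
  identity : ∀ a p q p′ q′ r s → (a ℤ.* p ℤ.+ p′) ℤ.* s ℤ.- r ℤ.* (a ℤ.* q ℤ.+ q′) ≡
                                 a ℤ.* (p ℤ.* s ℤ.- r ℤ.* q) ℤ.+ (p′ ℤ.* s ℤ.- r ℤ.* q′)
  identity = solve-∀
  identity′ : ∀ a b s → a ℤ.* (b ℤ.* s) ℤ.+ s ≡ s ℤ.* (a ℤ.* b ℤ.+ 1ℤ)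
  identity′ = solve-∀

-- A zero entry is allowed in every position but the last.
num-pos : ∀ n a → (∀ j → j ≤ n → 0ℤ ℤ.≤ a j) → 0ℤ ℤ.< a n → 0ℤ ℤ.< num a n
num-pos zero          a 0≤a 0<aₙ = 0<aₙ
num-pos (suc zero)    a 0≤a 0<aₙ = ℤ.+-mono-≤-< (*-nonNeg (0≤a 0 z≤n) (0≤a 1 (s≤s z≤n))) (ℤ.+<+ (s≤s z≤n))
num-pos (suc (suc n)) a 0≤a 0<aₙ = ℤ.+-mono-≤-<
  (*-nonNeg (0≤a 0 z≤n) (ℤ.<⇒≤ (num-pos (suc n) (a ∘ suc) (λ j j≤n → 0≤a (suc j) (s≤s j≤n)) 0<aₙ)))
  (num-pos n (a ∘ suc ∘ suc) (λ j j≤n → 0≤a (suc (suc j)) (s≤s (s≤s j≤n))) 0<aₙ)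

den-pos : ∀ n a → (∀ j → 1 ≤ j → j ≤ n → 0ℤ ℤ.≤ a j) → (1 ≤ n → 0ℤ ℤ.< a n) → 0ℤ ℤ.< den a n
den-pos zero    a 0≤a 0<aₙ = ℤ.+<+ (s≤s z≤n)
den-pos (suc n) a 0≤a 0<aₙ = num-pos n (a ∘ suc) (λ j j≤n → 0≤a (suc j) (s≤s z≤n) (s≤s j≤n)) (0<aₙ (s≤s z≤n))

convergent : (ℕ → ℤ) → ℕ → ℚ
convergent a n = frac (num a n) (den a n)

cf≡convergent : ∀ n a → (∀ j → 1 ≤ j → j ≤ n → 0ℤ ℤ.≤ a j) → (1 ≤ n → 0ℤ ℤ.< a n) → [ a ⨾ n ] ≡ convergent a n
cf≡convergent zero    a 0≤a 0<aₙ = frac-unique (ι (a 0)) (a 0) 1ℤ (ℤ.+<+ (s≤s z≤n)) (ℚ.*-identityʳ (ι (a 0)))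
cf≡convergent (suc n) a 0≤a 0<aₙ = begin
  ι (a 0) ℚ.+ [ a′ ⨾ n ] ⁻¹       ≡⟨ cong (λ r → ι (a 0) ℚ.+ r ⁻¹) (cf≡convergent n a′ (λ j _ j≤n → 0≤a′ j j≤n) (λ _ → 0<a′ₙ)) ⟩
  ι (a 0) ℚ.+ frac p q ⁻¹         ≡⟨ cong (ι (a 0) ℚ.+_) (frac-⁻¹ 0<p 0<q) ⟩
  ι (a 0) ℚ.+ frac q p            ≡⟨ frac-unique _ (a 0 ℤ.* p ℤ.+ q) p 0<p cross ⟩
  frac (a 0 ℤ.* p ℤ.+ q) p        ∎
  where
  open ≡-Reasoning
  a′ = a ∘ suc
  p = num a′ n
  q = den a′ n
  0≤a′ : ∀ j → j ≤ n → 0ℤ ℤ.≤ a′ j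
  0≤a′ j j≤n = 0≤a (suc j) (s≤s z≤n) (s≤s j≤n)
  0<a′ₙ : 0ℤ ℤ.< a′ n
  0<a′ₙ = 0<aₙ (s≤s z≤n)
  0<p = num-pos n a′ 0≤a′ 0<a′ₙ
  0<q = den-pos n a′ (λ j _ → 0≤a′ j) (λ _ → 0<a′ₙ)
  cross : (ι (a 0) ℚ.+ frac q p) ℚ.* ι p ≡ ι (a 0 ℤ.* p ℤ.+ q)
  cross = begin
    (ι (a 0) ℚ.+ frac q p) ℚ.* ι p              ≡⟨ ℚ.*-distribʳ-+ (ι p) (ι (a 0)) (frac q p) ⟩
    ι (a 0) ℚ.* ι p ℚ.+ frac q p ℚ.* ι p        ≡⟨ cong₂ ℚ._+_ (sym (ι-* (a 0) p)) (frac-cancel q 0<p) ⟩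
    ι (a 0 ℤ.* p) ℚ.+ ι q                       ≡⟨ ι-+ (a 0 ℤ.* p) q ⟨
    ι (a 0 ℤ.* p ℤ.+ q)                         ∎

-- A common divisor divides the determinant, which is 1 or -1.
num-den-coprime : ∀ a n → Coprime ∣ num a n ∣ ∣ den a n ∣
num-den-coprime a n {d} (d∣p , d∣q) = ℕ.∣1⇒≡1 (subst (d ℕ.∣_) (∣±1∣ (-1^n≡±1 n)) (ℤ.∣⇒∣ᵤ d∣±1))
  where
  ∣±1∣ : ∀ {i} → i ≡ 1ℤ ⊎ i ≡ -1ℤ → ∣ i ∣ ≡ 1
  ∣±1∣ (inj₁ refl) = refl
  ∣±1∣ (inj₂ refl) = refl
  d∣±1 : + d ℤ.∣ -1ℤ ℤ.^ n
  d∣±1 = subst (+ d ℤ.∣_) (determinant₁ a n) (ℤ.∣m∣n⇒∣m-n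
    (ℤ.∣n⇒∣m*n (num a (1 + n)) (ℤ.∣ᵤ⇒∣ d∣q)) (ℤ.∣m⇒∣m*n {m = num a n} (den a (1 + n)) (ℤ.∣ᵤ⇒∣ d∣p)))

denominator-convergent : ∀ a n → 0ℤ ℤ.< den a n → + (↧ₙ (convergent a n)) ≡ den a n
denominator-convergent a n 0<q with den a n | 0<q | num-den-coprime a n
... | + zero   | ℤ.+<+ () | _
... | ℤ.+[1+ q-1 ] | _ | coprime =
  cong +_ (trans (cong ↧ₙ_ (sym (/≡frac (num a n) (suc q-1)))) (frac-lowest-terms (num a n) (suc q-1) coprime))

num-cong : ∀ n a b → (∀ j → j ≤ n → a j ≡ b j) → num a n ≡ num b n
den-cong : ∀ n a b → (∀ j → j ≤ n → a j ≡ b j) → den a n ≡ den b n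
num-cong zero    a b a≡b = a≡b 0 z≤n
num-cong (suc n) a b a≡b = cong₂ ℤ._+_ (cong₂ ℤ._*_ (a≡b 0 z≤n) (num-cong n _ _ (λ j j≤n → a≡b (suc j) (s≤s j≤n))))
                                       (den-cong n _ _ (λ j j≤n → a≡b (suc j) (s≤s j≤n)))
den-cong zero    a b a≡b = refl
den-cong (suc n) a b a≡b = num-cong n _ _ (λ j j≤n → a≡b (suc j) (s≤s j≤n))

-- Limits

distance-sym : ∀ r s → ℚ.∣ r ℚ.- s ∣ ≡ ℚ.∣ s ℚ.- r ∣
distance-sym r s = trans (sym (ℚ.∣-p∣≡∣p∣ (r ℚ.- s))) (cong ℚ.∣_∣ (ℚ-solve 2 (λ r s → :- (r :- s) := s :- r) refl r s))

distance-triangle : ∀ r s t → ℚ.∣ r ℚ.- t ∣ ℚ.≤ ℚ.∣ r ℚ.- s ∣ ℚ.+ ℚ.∣ s ℚ.- t ∣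
distance-triangle r s t = subst (λ d → ℚ.∣ d ∣ ℚ.≤ ℚ.∣ r ℚ.- s ∣ ℚ.+ ℚ.∣ s ℚ.- t ∣)
  (ℚ-solve 3 (λ r s t → (r :- s) :+ (s :- t) := r :- t) refl r s t) (ℚ.∣p+q∣≤∣p∣+∣q∣ (r ℚ.- s) (s ℚ.- t))

Cauchy : (ℕ → ℚ) → Set
Cauchy s = ∀ ε → 0ℚ ℚ.< ε → ∃[ N ] (∀ i j → N ≤ i → N ≤ j → ℚ.∣ s i ℚ.- s j ∣ ℚ.< ε)

Vanishing : (ℕ → ℚ) → Set
Vanishing e = ∀ ε → 0ℚ ℚ.< ε → ∃[ N ] (∀ n → N ≤ n → e n ℚ.< ε)

module _ (s e : ℕ → ℚ) (step : ∀ n → ℚ.∣ s (suc n) ℚ.- s n ∣ ℚ.≤ e n ℚ.- e (suc n)) where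

  distance-telescope : ∀ d n → ℚ.∣ s (d + n) ℚ.- s n ∣ ℚ.≤ e n ℚ.- e (d + n)
  distance-telescope zero    n = ℚ.≤-reflexive (trans (cong ℚ.∣_∣ (ℚ.+-inverseʳ (s n))) (sym (ℚ.+-inverseʳ (e n))))
  distance-telescope (suc d) n = begin
    ℚ.∣ s (suc d + n) ℚ.- s n ∣
      ≤⟨ distance-triangle (s (suc d + n)) (s (d + n)) (s n) ⟩
    ℚ.∣ s (suc d + n) ℚ.- s (d + n) ∣ ℚ.+ ℚ.∣ s (d + n) ℚ.- s n ∣
      ≤⟨ ℚ.+-mono-≤ (step (d + n)) (distance-telescope d n) ⟩
    (e (d + n) ℚ.- e (suc d + n)) ℚ.+ (e n ℚ.- e (d + n))
      ≡⟨ ℚ-solve 3 (λ a b c → (a :- b) :+ (c :- a) := c :- b) refl (e (d + n)) (e (suc d + n)) (e n) ⟩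
    e n ℚ.- e (suc d + n)
      ∎
    where open ℚ.≤-Reasoning

  -- For i ≤ j the telescoped bound e i - e j is at most e i, which is small once i is large.
  summable-steps⇒Cauchy : (∀ n → 0ℚ ℚ.≤ e n) → Vanishing e → Cauchy s
  summable-steps⇒Cauchy 0≤e vanishing ε 0<ε = N , close
    where
    N = proj₁ (vanishing ε 0<ε)
    close-≤ : ∀ i j → N ≤ i → i ≤ j → ℚ.∣ s j ℚ.- s i ∣ ℚ.< ε
    close-≤ i j N≤i i≤j = begin-strict
      ℚ.∣ s j ℚ.- s i ∣                ≡⟨ cong (λ l → ℚ.∣ s l ℚ.- s i ∣) (ℕ.m∸n+n≡m i≤j) ⟨
      ℚ.∣ s (j ∸ i + i) ℚ.- s i ∣      ≤⟨ distance-telescope (j ∸ i) i ⟩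
      e i ℚ.- e (j ∸ i + i)            ≤⟨ ℚ.+-monoʳ-≤ (e i) (ℚ.neg-antimono-≤ (0≤e (j ∸ i + i))) ⟩
      e i ℚ.+ 0ℚ                       ≡⟨ ℚ.+-identityʳ (e i) ⟩
      e i                              <⟨ proj₂ (vanishing ε 0<ε) i N≤i ⟩
      ε                                ∎
      where open ℚ.≤-Reasoning
    close : ∀ i j → N ≤ i → N ≤ j → ℚ.∣ s i ℚ.- s j ∣ ℚ.< ε
    close i j N≤i N≤j with ℕ.≤-total i j
    ... | inj₁ i≤j = subst (ℚ._< ε) (distance-sym (s j) (s i)) (close-≤ i j N≤i i≤j)
    ... | inj₂ j≤i = close-≤ j i N≤j j≤i

-- An ε/2 argument. The index n attached to i only has to grow with i, since the continued fractions
-- run through three indices for each partial sum.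
⟶-transfer : ∀ s t e α → s ⟶ α → Vanishing e →
             (∀ T → ∃[ N ] (∀ i → N ≤ i → ∃[ n ] (T ≤ n × ℚ.∣ t i ℚ.- s n ∣ ℚ.≤ e n))) → t ⟶ α
⟶-transfer s t e α s⟶α vanishing close ε 0<ε = N₁ ℕ.⊔ N₃ , limit
  where
  0<½ε : 0ℚ ℚ.< ½ ℚ.* ε
  0<½ε = ℚ.positive⁻¹ _ {{ℚ.pos*pos⇒pos ½ ε {{ℚ.positive 0<ε}}}}
  N₁ = proj₁ (s⟶α _ 0<½ε)
  N₂ = proj₁ (vanishing _ 0<½ε)
  N₃ = proj₁ (close (N₁ ℕ.⊔ N₂))
  limit : ∀ i j → N₁ ℕ.⊔ N₃ ≤ i → N₁ ℕ.⊔ N₃ ≤ j → ℚ.∣ t i ℚ.- ℝ.seq α j ∣ ℚ.< ε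
  limit i j N≤i N≤j with n , T≤n , tᵢ≈sₙ ← proj₂ (close (N₁ ℕ.⊔ N₂)) i (ℕ.≤-trans (ℕ.m≤n⊔m N₁ N₃) N≤i) = begin-strict
    ℚ.∣ t i ℚ.- αⱼ ∣                             ≤⟨ distance-triangle (t i) (s n) αⱼ ⟩
    ℚ.∣ t i ℚ.- s n ∣ ℚ.+ ℚ.∣ s n ℚ.- αⱼ ∣       <⟨ ℚ.+-mono-<
                                                     (ℚ.≤-<-trans tᵢ≈sₙ (proj₂ (vanishing _ 0<½ε) n (ℕ.≤-trans (ℕ.m≤n⊔m N₁ N₂) T≤n)))
                                                     (proj₂ (s⟶α _ 0<½ε) n j (ℕ.≤-trans (ℕ.m≤m⊔n N₁ N₂) T≤n) (ℕ.≤-trans (ℕ.m≤m⊔n N₁ N₃) N≤j)) ⟩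
    ½ ℚ.* ε ℚ.+ ½ ℚ.* ε                          ≡⟨ ℚ.*-distribʳ-+ ε ½ ½ ⟨
    1ℚ ℚ.* ε                                     ≡⟨ ℚ.*-identityˡ ε ⟩
    ε                                            ∎
    where
    open ℚ.≤-Reasoning
    αⱼ = ℝ.seq α j

reciprocals-vanishing : (x : ℕ → ℕ) → (∀ n → n < x n) → Vanishing (λ n → ι (+ x n) ⁻¹)
reciprocals-vanishing x n<x ε@record{} 0<ε = d , small
  where
  -- The numerator of ε is at least 1, so ε ≥ 1 / d, while x n > n ≥ d from index d on.
  d = ↧ₙ ε
  open ℚ.≤-Reasoning
  1≤εd : 1ℚ ℚ.≤ ε ℚ.* ι (+ d)
  1≤εd = begin
    1ℚ                                ≤⟨ ι-mono-≤ (ℤ.i<j⇒suc[i]≤j (ℤ.positive⁻¹ (ℚ.↥ ε) {{ℚ.positive 0<ε}})) ⟩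
    ι (ℚ.↥ ε)                         ≡⟨ frac-cancel (ℚ.↥ ε) {+ d} (ℤ.+<+ (s≤s z≤n)) ⟨
    frac (ℚ.↥ ε) (+ d) ℚ.* ι (+ d)    ≡⟨ cong (ℚ._* ι (+ d)) (trans (sym (/≡frac (ℚ.↥ ε) d)) (ℚ.↥p/↧p≡p ε)) ⟩
    ε ℚ.* ι (+ d)                     ∎
  small : ∀ n → d ≤ n → ι (+ x n) ⁻¹ ℚ.< ε
  small n d≤n = begin-strict
    x⁻¹                               ≡⟨ ℚ.*-identityˡ x⁻¹ ⟨
    1ℚ ℚ.* x⁻¹                        <⟨ ℚ.*-monoˡ-<-pos x⁻¹ {{ℚ.positive (ι⁻¹-pos 0<x)}} (begin-strict
      1ℚ                                ≤⟨ 1≤εd ⟩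
      ε ℚ.* ι (+ d)                     <⟨ ℚ.*-monoʳ-<-pos ε {{ℚ.positive 0<ε}} (ι-mono-< (ℤ.+<+ (ℕ.≤-<-trans d≤n (n<x n)))) ⟩
      ε ℚ.* ι (+ x n)                   ∎) ⟩
    ε ℚ.* ι (+ x n) ℚ.* x⁻¹           ≡⟨ ℚ.*-assoc ε (ι (+ x n)) x⁻¹ ⟩
    ε ℚ.* (ι (+ x n) ℚ.* x⁻¹)         ≡⟨ cong (ε ℚ.*_) (ι-inverseʳ 0<x) ⟩
    ε ℚ.* 1ℚ                          ≡⟨ ℚ.*-identityʳ ε ⟩
    ε                                 ∎
    where
    x⁻¹ = ι (+ x n) ⁻¹
    0<x : 0ℤ ℤ.< + x n
    0<x = ℤ.+<+ (ℕ.≤-<-trans z≤n (n<x n))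

-- Dividing 2i ≤ j by i j gives 2 / j ≤ 1 / i. This makes the terms of the series telescope.
⁻¹-halve : ∀ {i j} → 0ℤ ℤ.< i → 0ℤ ℤ.< j → i ℤ.+ i ℤ.≤ j → ι j ⁻¹ ℚ.≤ ι i ⁻¹ ℚ.- ι j ⁻¹
⁻¹-halve {i} {j} 0<i 0<j 2i≤j = begin
  j⁻¹                                       ≡⟨ ℚ-solve 1 (λ r → r := r :+ r :- r) refl j⁻¹ ⟩
  j⁻¹ ℚ.+ j⁻¹ ℚ.- j⁻¹                       ≤⟨ ℚ.+-monoˡ-≤ (ℚ.- j⁻¹) (begin
    j⁻¹ ℚ.+ j⁻¹                               ≡⟨ cong₂ ℚ._+_ (ℚ.*-identityʳ j⁻¹) (ℚ.*-identityʳ j⁻¹) ⟨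
    j⁻¹ ℚ.* 1ℚ ℚ.+ j⁻¹ ℚ.* 1ℚ                 ≡⟨ cong (λ r → j⁻¹ ℚ.* r ℚ.+ j⁻¹ ℚ.* r) (ι-inverseʳ 0<i) ⟨
    j⁻¹ ℚ.* (ι i ℚ.* i⁻¹) ℚ.+ j⁻¹ ℚ.* (ι i ℚ.* i⁻¹)
                                              ≡⟨ ℚ-solve 3 (λ i i⁻¹ j⁻¹ → j⁻¹ :* (i :* i⁻¹) :+ j⁻¹ :* (i :* i⁻¹) := (i :+ i) :* (j⁻¹ :* i⁻¹)) refl (ι i) i⁻¹ j⁻¹ ⟩
    (ι i ℚ.+ ι i) ℚ.* (j⁻¹ ℚ.* i⁻¹)           ≡⟨ cong (ℚ._* (j⁻¹ ℚ.* i⁻¹)) (ι-+ i i) ⟨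
    ι (i ℤ.+ i) ℚ.* (j⁻¹ ℚ.* i⁻¹)             ≤⟨ ℚ.*-monoʳ-≤-nonNeg (j⁻¹ ℚ.* i⁻¹) {{ℚ.nonNeg*nonNeg⇒nonNeg j⁻¹ i⁻¹}} (ι-mono-≤ 2i≤j) ⟩
    ι j ℚ.* (j⁻¹ ℚ.* i⁻¹)                     ≡⟨ ℚ.*-assoc (ι j) j⁻¹ i⁻¹ ⟨
    ι j ℚ.* j⁻¹ ℚ.* i⁻¹                       ≡⟨ cong (ℚ._* i⁻¹) (ι-inverseʳ 0<j) ⟩
    1ℚ ℚ.* i⁻¹                                ≡⟨ ℚ.*-identityˡ i⁻¹ ⟩
    i⁻¹                                       ∎) ⟩
  i⁻¹ ℚ.- j⁻¹                               ∎
  where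
  open ℚ.≤-Reasoning
  i⁻¹ = ι i ⁻¹
  j⁻¹ = ι j ⁻¹
  instance
    nonNeg-i = ℚ.pos⇒nonNeg i⁻¹ {{ℚ.positive (ι⁻¹-pos 0<i)}}
    nonNeg-j = ℚ.pos⇒nonNeg j⁻¹ {{ℚ.positive (ι⁻¹-pos 0<j)}}

-- The expansion of α

splice : ℕ → (ℕ → ℤ) → (ℕ → ℤ) → ℕ → ℤ
splice n       b c zero    = b 0
splice zero    b c (suc j) = c j
splice (suc n) b c (suc j) = splice n (b ∘ suc) c j

splice-≤ : ∀ n b c j → j ≤ n → splice n b c j ≡ b j
splice-≤ n       b c zero    _         = refl
splice-≤ (suc n) b c (suc j) (s≤s j≤n) = splice-≤ n (b ∘ suc) c j j≤n

splice-> : ∀ n b c j → splice n b c (suc (j + n)) ≡ c j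
splice-> zero    b c j = cong c (ℕ.+-identityʳ j)
splice-> (suc n) b c j = trans (cong (splice n (b ∘ suc) c) (ℕ.+-suc j n)) (splice-> n (b ∘ suc) c j)

interleave : {A : Set} → (f g h : ℕ → A) → ℕ → A
interleave f g h zero    = f 0
interleave f g h (suc n) = interleave g h (f ∘ suc) n

-- The other residues modulo 3 reduce to this one by computation, because each step rotates the
-- three sequences.
interleave-*3 : ∀ {A : Set} (f g h : ℕ → A) n → interleave f g h (n * 3) ≡ f n
interleave-*3 f g h zero    = refl
interleave-*3 f g h (suc n) = interleave-*3 (f ∘ suc) (g ∘ suc) (h ∘ suc) n

interleave⁺ : ∀ {A : Set} (P : A → Set) {f g h : ℕ → A} →
              (∀ n → P (f n)) → (∀ n → P (g n)) → (∀ n → P (h n)) → ∀ n → P (interleave f g h n)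
interleave⁺ P Pf Pg Ph zero    = Pf 0
interleave⁺ P Pf Pg Ph (suc n) = interleave⁺ P Pg Ph (Pf ∘ suc) n

mod3-cases : ∀ i → ∃[ n ] (i ≡ n * 3 ⊎ i ≡ 1 + n * 3 ⊎ i ≡ 2 + n * 3)
mod3-cases zero    = 0 , inj₁ refl
mod3-cases (suc i) with mod3-cases i
... | n , inj₁ refl        = n , inj₂ (inj₁ refl)
... | n , inj₂ (inj₁ refl) = n , inj₂ (inj₂ refl)
... | n , inj₂ (inj₂ refl) = suc n , inj₁ refl

-1-nonNeg : ∀ {n} → 1 ≤ n → 0ℤ ℤ.≤ + n ℤ.- 1ℤ
-1-nonNeg {suc n} (s≤s _) = ℤ.+≤+ z≤n

-1-pos : ∀ {n} → 2 ≤ n → 0ℤ ℤ.< + n ℤ.- 1ℤ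
-1-pos {suc (suc n)} (s≤s (s≤s _)) = ℤ.+<+ (s≤s z≤n)

-- The even index 2k is `suc M`, so that q₍₂ₖ₋₁₎ is `den b M`. Evenness is recorded as the sign it
-- produces, and the recursions are shifted to start at 0.
module Expansion
  (M m : ℕ) (b : ℕ → ℤ) (x y u : ℕ → ℕ)
  (even : -1ℤ ℤ.^ suc M ≡ 1ℤ)
  (0<b : ∀ j → 1 ≤ j → j ≤ suc M → 0ℤ ℤ.< b j)
  (x₁≡q : + x 1 ≡ den b (suc M))
  (y₀≡ : + y 0 ≡ + m ℤ.* + x 1 ℤ.+ den b M ℤ.- 1ℤ)
  (2≤x₁ : 2 ≤ x 1) (1≤y₀ : 1 ≤ y 0)
  (1≤u : ∀ j → 1 ≤ u (suc j))
  (y-suc : ∀ j → y (suc j) ≡ y j * (1 + u (suc j) * x (suc j)))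
  (x-suc : ∀ j → x (2 + j) ≡ x (suc j) * y (suc j))
  where

  N : ℕ
  N = suc M

  a-first a-second a-third : ℕ → ℤ
  a-first zero    = + (m + u 1 * y 0) ℤ.- 1ℤ
  a-first (suc j) = + (u (2 + j) * y (suc j)) ℤ.- 1ℤ
  a-second j = 1ℤ
  a-third j  = + x (suc j) ℤ.- 1ℤ

  a : ℕ → ℤ
  a = splice N b (interleave a-first a-second a-third)

  -- Indices have the form `j * 3 + N` because `suc j * 3 + N` unfolds to `3 + (j * 3 + N)`, so
  -- inductions on j need no index arithmetic.
  a-first≡ : ∀ j → a (1 + (j * 3 + N)) ≡ a-first j
  a-first≡ j = trans (splice-> N b _ (j * 3)) (interleave-*3 a-first a-second a-third j)

  a-second≡ : ∀ j → a (2 + (j * 3 + N)) ≡ 1ℤ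
  a-second≡ j = trans (splice-> N b _ (1 + j * 3)) (interleave-*3 a-second a-third (a-first ∘ suc) j)

  a-third≡ : ∀ j → a (3 + (j * 3 + N)) ≡ + x (suc j) ℤ.- 1ℤ
  a-third≡ j = trans (splice-> N b _ (2 + j * 3)) (interleave-*3 a-third (a-first ∘ suc) (a-second ∘ suc) j)

  -- Growth of x and y, and signs of the partial quotients

  y-pos : ∀ j → 1 ≤ y j
  y-pos zero    = 1≤y₀
  y-pos (suc j) = subst (1 ≤_) (sym (y-suc j)) (ℕ.*-mono-≤ {1} {y j} {1} (y-pos j) (s≤s z≤n))

  x≥2 : ∀ j → 2 ≤ x (suc j)
  x≥2 zero    = 2≤x₁
  x≥2 (suc j) = subst (2 ≤_) (sym (x-suc j)) (ℕ.*-mono-≤ (x≥2 j) (y-pos (suc j)))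

  y≥2 : ∀ j → 2 ≤ y (suc j)
  y≥2 j = subst (2 ≤_) (sym (y-suc j))
    (ℕ.*-mono-≤ {1} {y j} (y-pos j) (s≤s (ℕ.*-mono-≤ (1≤u j) (ℕ.<⇒≤ (x≥2 j)))))

  x-doubles : ∀ j → x (suc j) + x (suc j) ≤ x (2 + j)
  x-doubles j = begin
    x (suc j) + x (suc j)    ≡⟨ double (x (suc j)) ⟩
    x (suc j) * 2            ≤⟨ ℕ.*-monoʳ-≤ (x (suc j)) (y≥2 j) ⟩
    x (suc j) * y (suc j)    ≡⟨ x-suc j ⟨
    x (2 + j)                ∎
    where
    open ℕ.≤-Reasoning
    double : ∀ n → n + n ≡ n * 2
    double = ℕ-solve-∀

  -- Doubling a number that is at least 1 increases it by at least 1.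
  n<x : ∀ n → n < x (suc n)
  n<x zero    = ℕ.<⇒≤ (x≥2 0)
  n<x (suc n) = ℕ.≤-trans (ℕ.+-mono-≤ {1} (ℕ.<⇒≤ (x≥2 n)) (n<x n)) (x-doubles n)

  0<x : ∀ j → 0ℤ ℤ.< + x (suc j)
  0<x j = ℤ.+<+ (ℕ.<⇒≤ (x≥2 j))

  -- The shift by one skips `a-first 0`, the only partial quotient of positive index that can be
  -- zero.
  0<a-rest : ∀ j → 0ℤ ℤ.< interleave a-first a-second a-third (suc j)
  0<a-rest = interleave⁺ (0ℤ ℤ.<_) (λ _ → ℤ.+<+ (s≤s z≤n)) (λ j → -1-pos (x≥2 j))
    (λ j → -1-pos (ℕ.*-mono-≤ {1} (1≤u (suc j)) (y≥2 j)))

  -- The predicate is left open to serve twice: nonnegativity always holds, positivity only when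
  -- `a-first 0` is positive.
  a-cases : (P : ℤ → Set) → (∀ {i} → 0ℤ ℤ.< i → P i) → P (a-first 0) → ∀ j → 1 ≤ j → P (a j)
  a-cases P pos⇒P P₀ j 1≤j with ℕ.≤-<-connex j N
  ... | inj₁ j≤N = subst P (sym (splice-≤ N b _ j j≤N)) (pos⇒P (0<b j 1≤j j≤N))
  ... | inj₂ N<j = subst (P ∘ a) (trans (sym (ℕ.+-suc (j ∸ suc N) N)) (ℕ.m∸n+n≡m N<j))
                     (subst P (sym (splice-> N b _ (j ∸ suc N))) (rest (j ∸ suc N)))
    where
    rest : ∀ i → P (interleave a-first a-second a-third i)
    rest zero    = P₀
    rest (suc i) = pos⇒P (0<a-rest i)

  0≤a : ∀ j → 1 ≤ j → 0ℤ ℤ.≤ a j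
  0≤a = a-cases (0ℤ ℤ.≤_) ℤ.<⇒≤ (-1-nonNeg (ℕ.≤-trans (ℕ.*-mono-≤ {1} (1≤u 0) 1≤y₀) (ℕ.m≤n+m _ m)))

  0<a-beyond : ∀ i → 0ℤ ℤ.< a (2 + (i + N))
  0<a-beyond i = subst (0ℤ ℤ.<_) (sym (splice-> N b _ (suc i))) (0<a-rest i)

  -- Denominators of the convergents

  y-suc-ℤ : ∀ j → + y (suc j) ≡ + y j ℤ.* (1ℤ ℤ.+ + u (suc j) ℤ.* + x (suc j))
  y-suc-ℤ j = trans (cong +_ (y-suc j)) (trans (ℤ.pos-* (y j) _)
    (cong (λ i → + y j ℤ.* (1ℤ ℤ.+ i)) (ℤ.pos-* (u (suc j)) (x (suc j)))))

  x-suc-ℤ : ∀ j → + x (2 + j) ≡ + x (suc j) ℤ.* + y (suc j)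
  x-suc-ℤ j = trans (cong +_ (x-suc j)) (ℤ.pos-* (x (suc j)) (y (suc j)))

  den-a≡den-b : ∀ n → n ≤ N → den a n ≡ den b n
  den-a≡den-b n n≤N = den-cong n a b (λ j j≤n → splice-≤ N b _ j (ℕ.≤-trans j≤n n≤N))

  -- One simultaneous induction along the indices: each value follows from the two before it by
  -- `den-recurrence`.
  q-0 : ∀ j → den a (j * 3 + N) ≡ + x (suc j)
  q-1 : ∀ j → den a (1 + (j * 3 + N)) ≡ + y (suc j) ℤ.- + x (suc j) ℤ.+ 1ℤ
  q-2 : ∀ j → den a (2 + (j * 3 + N)) ≡ + y (suc j) ℤ.+ 1ℤ

  q-0 zero    = trans (den-a≡den-b N ℕ.≤-refl) (sym x₁≡q)
  q-0 (suc j) = begin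
    den a (3 + (j * 3 + N))
      ≡⟨ den-recurrence a (1 + (j * 3 + N)) ⟩
    a (3 + (j * 3 + N)) ℤ.* den a (2 + (j * 3 + N)) ℤ.+ den a (1 + (j * 3 + N))
      ≡⟨ cong₂ ℤ._+_ (cong₂ ℤ._*_ (a-third≡ j) (q-2 j)) (q-1 j) ⟩
    _ ≡⟨ identity (+ x (suc j)) (+ y (suc j)) ⟩
    + x (suc j) ℤ.* + y (suc j)
      ≡⟨ x-suc-ℤ j ⟨
    + x (2 + j)
      ∎
    where
    open ≡-Reasoning
    identity : ∀ x y → (x ℤ.- 1ℤ) ℤ.* (y ℤ.+ 1ℤ) ℤ.+ (y ℤ.- x ℤ.+ 1ℤ) ≡ x ℤ.* y
    identity = solve-∀

  q-1 zero = begin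
    den a (2 + M)
      ≡⟨ den-recurrence a M ⟩
    a (2 + M) ℤ.* den a N ℤ.+ den a M
      ≡⟨ cong₂ ℤ._+_ (cong₂ ℤ._*_ (trans (a-first≡ 0) a₁) (q-0 0)) (den-a≡den-b M (ℕ.n≤1+n M)) ⟩
    (+ m ℤ.+ + u 1 ℤ.* + y 0 ℤ.- 1ℤ) ℤ.* + x 1 ℤ.+ den b M
      -- The bracket split off here is exactly the prescribed value of y₀; this is what dictates
      -- that initial value.
      ≡⟨ identity (+ m) (+ u 1) (+ y 0) (+ x 1) (den b M) ⟩
    (+ m ℤ.* + x 1 ℤ.+ den b M ℤ.- 1ℤ) ℤ.+ + u 1 ℤ.* + y 0 ℤ.* + x 1 ℤ.- + x 1 ℤ.+ 1ℤ
      ≡⟨ cong (λ i → i ℤ.+ + u 1 ℤ.* + y 0 ℤ.* + x 1 ℤ.- + x 1 ℤ.+ 1ℤ) y₀≡ ⟨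
    + y 0 ℤ.+ + u 1 ℤ.* + y 0 ℤ.* + x 1 ℤ.- + x 1 ℤ.+ 1ℤ
      ≡⟨ identity′ (+ u 1) (+ y 0) (+ x 1) ⟩
    + y 0 ℤ.* (1ℤ ℤ.+ + u 1 ℤ.* + x 1) ℤ.- + x 1 ℤ.+ 1ℤ
      ≡⟨ cong (λ i → i ℤ.- + x 1 ℤ.+ 1ℤ) (y-suc-ℤ 0) ⟨
    + y 1 ℤ.- + x 1 ℤ.+ 1ℤ
      ∎
    where
    open ≡-Reasoning
    a₁ : + (m + u 1 * y 0) ℤ.- 1ℤ ≡ + m ℤ.+ + u 1 ℤ.* + y 0 ℤ.- 1ℤ
    a₁ = cong (λ i → + m ℤ.+ i ℤ.- 1ℤ) (ℤ.pos-* (u 1) (y 0))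
    identity : ∀ m u y x q → (m ℤ.+ u ℤ.* y ℤ.- 1ℤ) ℤ.* x ℤ.+ q ≡ (m ℤ.* x ℤ.+ q ℤ.- 1ℤ) ℤ.+ u ℤ.* y ℤ.* x ℤ.- x ℤ.+ 1ℤ
    identity = solve-∀
    identity′ : ∀ u y x → y ℤ.+ u ℤ.* y ℤ.* x ℤ.- x ℤ.+ 1ℤ ≡ y ℤ.* (1ℤ ℤ.+ u ℤ.* x) ℤ.- x ℤ.+ 1ℤ
    identity′ = solve-∀
  q-1 (suc j) = begin
    den a (4 + (j * 3 + N))
      ≡⟨ den-recurrence a (2 + (j * 3 + N)) ⟩
    a (4 + (j * 3 + N)) ℤ.* den a (3 + (j * 3 + N)) ℤ.+ den a (2 + (j * 3 + N))
      ≡⟨ cong₂ ℤ._+_ (cong₂ ℤ._*_ (trans (a-first≡ (suc j)) (cong (ℤ._- 1ℤ) (ℤ.pos-* (u (2 + j)) (y (suc j))))) (q-0 (suc j))) (q-2 j) ⟩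
    _ ≡⟨ identity (+ u (2 + j)) (+ y (suc j)) (+ x (2 + j)) ⟩
    + y (suc j) ℤ.* (1ℤ ℤ.+ + u (2 + j) ℤ.* + x (2 + j)) ℤ.- + x (2 + j) ℤ.+ 1ℤ
      ≡⟨ cong (λ i → i ℤ.- + x (2 + j) ℤ.+ 1ℤ) (y-suc-ℤ (suc j)) ⟨
    + y (2 + j) ℤ.- + x (2 + j) ℤ.+ 1ℤ
      ∎
    where
    open ≡-Reasoning
    identity : ∀ u y x → (u ℤ.* y ℤ.- 1ℤ) ℤ.* x ℤ.+ (y ℤ.+ 1ℤ) ≡ y ℤ.* (1ℤ ℤ.+ u ℤ.* x) ℤ.- x ℤ.+ 1ℤ
    identity = solve-∀

  q-2 j = begin
    den a (2 + (j * 3 + N))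
      ≡⟨ den-recurrence a (j * 3 + N) ⟩
    a (2 + (j * 3 + N)) ℤ.* den a (1 + (j * 3 + N)) ℤ.+ den a (j * 3 + N)
      ≡⟨ cong₂ ℤ._+_ (cong₂ ℤ._*_ (a-second≡ j) (q-1 j)) (q-0 j) ⟩
    _ ≡⟨ identity (+ x (suc j)) (+ y (suc j)) ⟩
    + y (suc j) ℤ.+ 1ℤ
      ∎
    where
    open ≡-Reasoning
    identity : ∀ x y → 1ℤ ℤ.* (y ℤ.- x ℤ.+ 1ℤ) ℤ.+ x ≡ y ℤ.+ 1ℤ
    identity = solve-∀

  -- Partial sums as convergents

  0<q-0 : ∀ j → 0ℤ ℤ.< den a (j * 3 + N)
  0<q-0 j = subst (0ℤ ℤ.<_) (sym (q-0 j)) (0<x j)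

  -- Three sign changes amount to one, and 2k is even. The exponent `2 + j` is the index of the
  -- matching term of the series.
  sign : ∀ j → -1ℤ ℤ.^ (j * 3 + N) ≡ -1ℤ ℤ.^ (2 + j)
  sign zero    = even
  sign (suc j) = trans (identity (-1ℤ ℤ.^ (j * 3 + N))) (cong (-1ℤ ℤ.*_) (sign j))
    where
    identity : ∀ i → -1ℤ ℤ.* (-1ℤ ℤ.* (-1ℤ ℤ.* i)) ≡ -1ℤ ℤ.* i
    identity = solve-∀

  -- It plays two parts: the telescoping majorant for the partial sums, and the bound on the
  -- distance from a partial sum to the two convergents after it.
  e : ℕ → ℚ
  e j = ι (+ x (suc j)) ⁻¹

  0≤e : ∀ j → 0ℚ ℚ.≤ e j
  0≤e j = ℚ.<⇒≤ (ι⁻¹-pos (0<x j))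

  e-vanishing : Vanishing e
  e-vanishing = reciprocals-vanishing (x ∘ suc) n<x

  convergent-step : ∀ j → convergent a (suc j * 3 + N) ℚ.- convergent a (j * 3 + N) ≡ ι (-1ℤ ℤ.^ (2 + j)) ℚ.* e (suc j)
  convergent-step j = begin
    convergent a (3 + n) ℚ.- convergent a n
      ≡⟨ frac-difference (num a n) (den a n) (num a (3 + n)) (den a (3 + n)) (0<q-0 j) (0<q-0 (suc j)) (trans (determinant₃ a n) det) ⟩
    ι (-1ℤ ℤ.^ (2 + j) ℤ.* + x (suc j)) ℚ.* (ι (den a n) ⁻¹ ℚ.* ι (den a (3 + n)) ⁻¹)
      ≡⟨ cong₂ ℚ._*_ (ι-* (-1ℤ ℤ.^ (2 + j)) (+ x (suc j))) (cong₂ (λ q q′ → ι q ⁻¹ ℚ.* ι q′ ⁻¹) (q-0 j) (q-0 (suc j))) ⟩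
    s ℚ.* ι (+ x (suc j)) ℚ.* (e j ℚ.* e (suc j))
      ≡⟨ ℚ-solve 4 (λ s x x⁻¹ e → s :* x :* (x⁻¹ :* e) := s :* ((x :* x⁻¹) :* e)) refl s (ι (+ x (suc j))) (e j) (e (suc j)) ⟩
    s ℚ.* (ι (+ x (suc j)) ℚ.* e j ℚ.* e (suc j))
      ≡⟨ cong (λ r → s ℚ.* (r ℚ.* e (suc j))) (ι-inverseʳ (0<x j)) ⟩
    s ℚ.* (1ℚ ℚ.* e (suc j))
      ≡⟨ cong (s ℚ.*_) (ℚ.*-identityˡ (e (suc j))) ⟩
    s ℚ.* e (suc j)
      ∎
    where
    open ≡-Reasoning
    n = j * 3 + N
    s = ι (-1ℤ ℤ.^ (2 + j))
    det : -1ℤ ℤ.^ n ℤ.* (a (3 + n) ℤ.* a (2 + n) ℤ.+ 1ℤ) ≡ -1ℤ ℤ.^ (2 + j) ℤ.* + x (suc j)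
    det = cong₂ ℤ._*_ (sign j) (trans (cong₂ (λ i i′ → i ℤ.* i′ ℤ.+ 1ℤ) (a-third≡ j) (a-second≡ j)) (identity (+ x (suc j))))
      where
      identity : ∀ x → (x ℤ.- 1ℤ) ℤ.* 1ℤ ℤ.+ 1ℤ ≡ x
      identity = solve-∀

  convergent-a≡b : convergent a N ≡ convergent b N
  convergent-a≡b = cong₂ frac (num-cong N a b (splice-≤ N b _)) (den-a≡den-b N ℕ.≤-refl)

  S : ℕ → ℚ
  S = partialSum (convergent b N) x

  S≡convergent : ∀ n → S n ≡ convergent a (n * 3 + N)
  S≡convergent zero    = trans (ℚ.+-identityʳ (convergent b N)) (sym convergent-a≡b)
  S≡convergent (suc n) = begin
    -- The newest summand has index `2 + n` and is by definition the right-hand side of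
    -- `convergent-step`.
    S (suc n)                                                 ≡⟨ ℚ.+-assoc (convergent b N) _ _ ⟨
    S n ℚ.+ ι (-1ℤ ℤ.^ (2 + n)) ℚ.* e (suc n)                 ≡⟨ cong₂ ℚ._+_ (S≡convergent n) (sym (convergent-step n)) ⟩
    c ℚ.+ (c′ ℚ.- c)                                          ≡⟨ ℚ-solve 2 (λ c c′ → c :+ (c′ :- c) := c′) refl c c′ ⟩
    c′                                                        ∎
    where
    open ≡-Reasoning
    c  = convergent a (n * 3 + N)
    c′ = convergent a (suc n * 3 + N)

  S-step : ∀ n → ℚ.∣ S (suc n) ℚ.- S n ∣ ℚ.≤ e n ℚ.- e (suc n)
  S-step n = begin
    ℚ.∣ S (suc n) ℚ.- S n ∣                        ≡⟨ cong ℚ.∣_∣ (trans (cong₂ ℚ._-_ (S≡convergent (suc n)) (S≡convergent n)) (convergent-step n)) ⟩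
    ℚ.∣ ι (-1ℤ ℤ.^ (2 + n)) ℚ.* e (suc n) ∣        ≡⟨ ∣±r∣≡r (2 + n) (e (suc n)) (0≤e (suc n)) ⟩
    e (suc n)                                      ≤⟨ ⁻¹-halve (0<x n) (0<x (suc n)) (ℤ.+≤+ (x-doubles n)) ⟩
    e n ℚ.- e (suc n)                              ∎
    where open ℚ.≤-Reasoning

  S-cauchy : Cauchy S
  S-cauchy = summable-steps⇒Cauchy S e S-step 0≤e e-vanishing

  -- Convergence of the continued fraction

  cf-beyond : ∀ i → [ a ⨾ 2 + (i + N) ] ≡ convergent a (2 + (i + N))
  cf-beyond i = cf≡convergent (2 + (i + N)) a (λ j 1≤j _ → 0≤a j 1≤j) (λ _ → 0<a-beyond i)

  0<den-beyond : ∀ i → 0ℤ ℤ.< den a (2 + (i + N))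
  0<den-beyond i = den-pos (2 + (i + N)) a (λ j 1≤j _ → 0≤a j 1≤j) (λ _ → 0<a-beyond i)

  cf-close : ∀ n l → 0ℤ ℤ.< den a l → [ a ⨾ l ] ≡ convergent a l →
             num a l ℤ.* den a (n * 3 + N) ℤ.- num a (n * 3 + N) ℤ.* den a l ≡ -1ℤ ℤ.^ (n * 3 + N) →
             ℚ.∣ [ a ⨾ l ] ℚ.- S n ∣ ℚ.≤ e n
  cf-close n l 0<q cf≡ det = begin
    ℚ.∣ [ a ⨾ l ] ℚ.- S n ∣                         ≡⟨ cong₂ (λ r s → ℚ.∣ r ℚ.- s ∣) cf≡ (S≡convergent n) ⟩
    ℚ.∣ convergent a l ℚ.- convergent a k ∣         ≤⟨ frac-close k (num a k) (den a k) (num a l) (den a l) (0<q-0 n) 0<q det ⟩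
    ι (den a k) ⁻¹                                  ≡⟨ cong (λ q → ι q ⁻¹) (q-0 n) ⟩
    e n                                             ∎
    where
    open ℚ.≤-Reasoning
    k = n * 3 + N

  -- Indices up to N + 1 are avoided: if a (N + 1) = 0, then [ a ⨾ N + 1 ]
  -- involves the reciprocal of 0.
  cf-close₀ : ∀ n → ℚ.∣ [ a ⨾ suc n * 3 + N ] ℚ.- S (suc n) ∣ ℚ.≤ e (suc n)
  cf-close₀ n = begin
    ℚ.∣ [ a ⨾ suc n * 3 + N ] ℚ.- S (suc n) ∣       ≡⟨ cong (λ r → ℚ.∣ r ℚ.- S (suc n) ∣) (trans (cf-beyond (1 + n * 3)) (sym (S≡convergent (suc n)))) ⟩
    ℚ.∣ S (suc n) ℚ.- S (suc n) ∣                   ≡⟨ cong ℚ.∣_∣ (ℚ.+-inverseʳ (S (suc n))) ⟩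
    0ℚ                                              ≤⟨ 0≤e (suc n) ⟩
    e (suc n)                                       ∎
    where open ℚ.≤-Reasoning

  cf-close₁ : ∀ n → ℚ.∣ [ a ⨾ 1 + (suc n * 3 + N) ] ℚ.- S (suc n) ∣ ℚ.≤ e (suc n)
  cf-close₁ n = cf-close (suc n) (1 + (suc n * 3 + N)) (0<den-beyond (2 + n * 3)) (cf-beyond (2 + n * 3)) (determinant₁ a (suc n * 3 + N))

  -- Two indices further on the determinant is still a bare sign, because the partial quotient
  -- multiplying it is 1.
  cf-close₂ : ∀ n → ℚ.∣ [ a ⨾ 2 + (suc n * 3 + N) ] ℚ.- S (suc n) ∣ ℚ.≤ e (suc n)
  cf-close₂ n = cf-close (suc n) (2 + (suc n * 3 + N)) (0<den-beyond (suc n * 3)) (cf-beyond (suc n * 3))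
    (trans (determinant₂ a (suc n * 3 + N)) (trans (cong (ℤ._* -1ℤ ℤ.^ (suc n * 3 + N)) (a-second≡ (suc n))) (ℤ.*-identityˡ _)))

  cf⟶ : ∀ α → S ⟶ α → (λ n → [ a ⨾ n ]) ⟶ α
  -- The threshold uses `suc T`, so every index considered is at least N + 3, past the possible zero
  -- entry at N + 1. The remainder modulo 3 selects one of the three estimates.
  cf⟶ α S⟶α = ⟶-transfer S (λ n → [ a ⨾ n ]) e α S⟶α e-vanishing (λ T → suc T * 3 + N , λ i N≤i → close T i N≤i (mod3-cases (i ∸ (suc T * 3 + N))))
    where
    shift : ∀ T n N → n * 3 + (suc T * 3 + N) ≡ suc (n + T) * 3 + N
    shift = ℕ-solve-∀
    close : ∀ T i → suc T * 3 + N ≤ i → let d = i ∸ (suc T * 3 + N) in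
            ∃[ n ] (d ≡ n * 3 ⊎ d ≡ 1 + n * 3 ⊎ d ≡ 2 + n * 3) →
            ∃[ n ] (T ≤ n × ℚ.∣ [ a ⨾ i ] ℚ.- S n ∣ ℚ.≤ e n)
    close T i N≤i (n , cases) = suc (n + T) , ℕ.m≤n⇒m≤1+n (ℕ.m≤n+m T n) , bound cases
      where
      index : ∀ r → i ∸ (suc T * 3 + N) ≡ r + n * 3 → i ≡ r + (suc (n + T) * 3 + N)
      index r eq = begin
        i                                              ≡⟨ ℕ.m∸n+n≡m N≤i ⟨
        i ∸ (suc T * 3 + N) + (suc T * 3 + N)          ≡⟨ cong (_+ (suc T * 3 + N)) eq ⟩
        r + n * 3 + (suc T * 3 + N)                    ≡⟨ ℕ.+-assoc r (n * 3) (suc T * 3 + N) ⟩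
        r + (n * 3 + (suc T * 3 + N))                  ≡⟨ cong (λ l → r + l) (shift T n N) ⟩
        r + (suc (n + T) * 3 + N)                      ∎
        where open ≡-Reasoning
      Bound : ℕ → Set
      Bound l = ℚ.∣ [ a ⨾ l ] ℚ.- S (suc (n + T)) ∣ ℚ.≤ e (suc (n + T))
      bound : let d = i ∸ (suc T * 3 + N) in d ≡ n * 3 ⊎ d ≡ 1 + n * 3 ⊎ d ≡ 2 + n * 3 → Bound i
      bound (inj₁ eq)        = subst Bound (sym (index 0 eq)) (cf-close₀ (n + T))
      bound (inj₂ (inj₁ eq)) = subst Bound (sym (index 1 eq)) (cf-close₁ (n + T))
      bound (inj₂ (inj₂ eq)) = subst Bound (sym (index 2 eq)) (cf-close₂ (n + T))

-- From the hypotheses of the theorem to those of the expansion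

-1^2k≡1 : ∀ k → -1ℤ ℤ.^ (2 * k) ≡ 1ℤ
-1^2k≡1 k = trans (sym (ℤ.^-*-assoc -1ℤ 2 k)) (ℤ.^-zeroˡ k)

≡-1⇒suc : ∀ {m n} → + m ≡ + n ℤ.- 1ℤ → n ≡ suc m
≡-1⇒suc {n = suc n} eq = cong suc (sym (ℤ.+-injective eq))

-- Identifies denominators in lowest terms with continuants, for both q₂ₖ and q₍₂ₖ₋₁₎.
cf-denominator : ∀ n b → (∀ j → 1 ≤ j → j ≤ n → 0ℤ ℤ.< b j) → + (↧ₙ [ b ⨾ n ]) ≡ den b n
cf-denominator n b 0<b = trans (cong (λ r → + (↧ₙ r)) (cf≡convergent n b 0≤b 0<bₙ))
                               (denominator-convergent b n (den-pos n b 0≤b 0<bₙ))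
  where
  0≤b : ∀ j → 1 ≤ j → j ≤ n → 0ℤ ℤ.≤ b j
  0≤b j 1≤j j≤n = ℤ.<⇒≤ (0<b j 1≤j j≤n)
  0<bₙ : 1 ≤ n → 0ℤ ℤ.< b n
  0<bₙ 1≤n = 0<b n 1≤n ℕ.≤-refl

-- As u y ≥ 1, the bound can fail only for m = 0 and u y = 1. Then u = y = 1, and the equation for y
-- reads d = 2.
exceptional-case : ∀ {m u y q d} → 1 ≤ u → 1 ≤ y → m * q + d ≡ suc y → ¬ (2 ≤ m + u * y) → m ≡ 0 × u ≡ 1 × d ≡ 2
exceptional-case {suc m} {u} {y} 1≤u 1≤y _ 2≰ = contradiction (s≤s (ℕ.≤-trans (ℕ.*-mono-≤ {1} 1≤u 1≤y) (ℕ.m≤n+m _ m))) 2≰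
exceptional-case {zero} {u} {y} {d = d} 1≤u 1≤y d≡ 2≰ =
  refl , ℕ.m*n≡1⇒m≡1 u y uy≡1 , trans d≡ (cong suc (ℕ.m*n≡1⇒n≡1 u y uy≡1))
  where
  uy≡1 : u * y ≡ 1
  uy≡1 = ℕ.≤-antisym (ℕ.≤-pred (ℕ.≰⇒> 2≰)) (ℕ.*-mono-≤ {1} 1≤u 1≤y)

-- This amounts to y₀ ≥ 1. The restriction m ≥ 1 for d = 1 supplies the missing unit through m q ≥
-- 1.
2≤mq+d : ∀ {m q d} → 1 ≤ q → 1 ≤ d → (d ≡ 1 → 1 ≤ m) → 2 ≤ m * q + d
2≤mq+d {m} {q} {d} 1≤q 1≤d d≡1⇒1≤m with ℕ.m≤n⇒m<n∨m≡n 1≤d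
... | inj₁ 2≤d = ℕ.≤-trans 2≤d (ℕ.m≤n+m d (m * q))
... | inj₂ 1≡d = ℕ.+-mono-≤ {1} (ℕ.*-mono-≤ {1} (d≡1⇒1≤m (sym 1≡d)) 1≤q) 1≤d

-- Positivity of the partial quotients is conditional because m = 0, u₁ = 1, q₍₂ₖ₋₁₎ = 2 give y₀ = 1
-- and hence a zero at index 2k + 1. The limit is asserted in that case as well.
theorem2p2 : (p : ℤ) (q : ℕ) .{{_ : NonZero q}} → Coprime ∣ p ∣ q →
    (m : ℕ) →
    (u : ℕ → ℕ) → (∀ n → 1 ≤ n → 1 ≤ u n) →
    (k : ℕ) (b : ℕ → ℤ) →
    (∀ j → 1 ≤ j → j ≤ 2 * k → 0ℤ ℤ.< b j) →
    p / q ≡ [ b ⨾ 2 * k ] →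
    1 < q →
    (x y : ℕ → ℕ) →
    x 1 ≡ q →
    + y 0 ≡ + (m * q + q[ b , 2 * k -1]) ℤ.- 1ℤ →
    (∀ j → 1 ≤ j → y j ≡ y (j ∸ 1) * (1 + u j * x j)) →
    (∀ j → 1 ≤ j → x (j + 1) ≡ x j * y j) →
    (q[ b , 2 * k -1] ≡ 1 → 1 ≤ m) →
    (∃[ α ] partialSum (p / q) x ⟶ α)
    ×
    (∀ α → partialSum (p / q) x ⟶ α →
    ∃[ a ]
    ((λ n → [ a ⨾ n ]) ⟶ α)
    × (∀ j → j ≤ 2 * k → a j ≡ b j)
    × a (2 * k + 1) ≡ + (m + u 1 * y 0) ℤ.- 1ℤ
    × (∀ j → 1 ≤ j →
    a (2 * k + 3 * j ∸ 1) ≡ 1ℤ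
    × a (2 * k + 3 * j) ≡ + x j ℤ.- 1ℤ
    × a (2 * k + 3 * j + 1) ≡ + (u (j + 1) * y j) ℤ.- 1ℤ)
    × (¬ (m ≡ 0 × u 1 ≡ 1 × q[ b , 2 * k -1] ≡ 2) →
    ∀ j → 1 ≤ j → 0ℤ ℤ.< a j))
-- For k = 0 the fraction is the integer b₀, whose denominator 1 contradicts q > 1.
theorem2p2 p q coprime m u 1≤u zero b 0<b p/q≡ 1<q x y x₁≡q y₀≡ y-rec x-rec d≡1⇒1≤m =
  contradiction (sym q≡1) (ℕ.<⇒≢ 1<q)
  where
  q≡1 : q ≡ 1
  q≡1 = ℤ.+-injective (trans (cong +_ (sym (frac-lowest-terms p q coprime)))
                             (trans (cong (λ r → + (↧ₙ r)) p/q≡) (cf-denominator 0 b 0<b)))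
theorem2p2 p q coprime m u 1≤u (suc k) b 0<b p/q≡ 1<q x y x₁≡q y₀≡ y-rec x-rec d≡1⇒1≤m =
  -- The partial sums themselves represent α, so their convergence to α is literally the Cauchy
  -- property.
  (record { seq = partialSum (p / q) x ; cauchy = cauchy } , cauchy) ,
  λ α S⟶α → a
    , cf⟶ α (subst (λ r → partialSum r x ⟶ α) p/q≡convergent S⟶α)
    , splice-≤ N b _
    , trans (cong a (ℕ.+-comm N 1)) (a-first≡ 0)
    , (λ where
        (suc j) 1≤j →
            trans (cong (λ l → a (l ∸ 1)) (index N j)) (a-second≡ j)
          , trans (cong a (index N j)) (a-third≡ j)
          , trans (cong a (trans (ℕ.+-comm (N + 3 * suc j) 1) (cong suc (index N j))))
                  (trans (a-first≡ (suc j)) (cong (λ l → + (u l * y (suc j)) ℤ.- 1ℤ) (ℕ.+-comm 1 (suc j)))))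
    -- Only the entry at 2k + 1 is in doubt. Decidability of `≤` turns the contrapositive of
    -- `exceptional-case` into the bound.
    , λ ¬exceptional → a-cases (0ℤ ℤ.<_) (λ 0<i → 0<i)
        (-1-pos (decidable-stable (2 ℕ.≤? _) (λ 2≰ → ¬exceptional (exceptional-case (1≤u 1 ℕ.≤-refl) 1≤y₀ mq+d≡ 2≰))))
  where
  -- Chosen so that `2 * suc k` unfolds to `suc M`.
  M = k + suc (k + 0)
  d = q[ b , 2 * suc k -1]
  mq+d≡ : m * q + d ≡ suc (y 0)
  mq+d≡ = ≡-1⇒suc y₀≡
  1≤y₀ : 1 ≤ y 0
  -- Here d is the denominator of a rational, a successor by definition, so `s≤s z≤n` proves 1 ≤ d.
  1≤y₀ = ℕ.≤-pred (subst (2 ≤_) mq+d≡ (2≤mq+d {m} (ℕ.<⇒≤ 1<q) (s≤s z≤n) d≡1⇒1≤m))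
  +d≡ : + d ≡ den b M
  +d≡ = cf-denominator M b (λ j 1≤j j≤M → 0<b j 1≤j (ℕ.m≤n⇒m≤1+n j≤M))
  +q≡ : + q ≡ den b (suc M)
  +q≡ = trans (cong +_ (sym (frac-lowest-terms p q coprime)))
              (trans (cong (λ r → + (↧ₙ r)) p/q≡) (cf-denominator (suc M) b 0<b))
  y₀≡′ : + y 0 ≡ + m ℤ.* + x 1 ℤ.+ den b M ℤ.- 1ℤ
  y₀≡′ = trans y₀≡ (cong₂ (λ i j → i ℤ.+ j ℤ.- 1ℤ) (trans (ℤ.pos-* m q) (cong (λ l → + m ℤ.* + l) (sym x₁≡q))) +d≡)
  p/q≡convergent : p / q ≡ convergent b (suc M)
  p/q≡convergent = trans p/q≡ (cf≡convergent (suc M) b (λ j 1≤j j≤N → ℤ.<⇒≤ (0<b j 1≤j j≤N)) (λ 1≤N → 0<b (suc M) 1≤N ℕ.≤-refl))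
  open Expansion M m b x y u (-1^2k≡1 (suc k)) 0<b (trans (cong +_ x₁≡q) +q≡) y₀≡′
    (subst (2 ≤_) (sym x₁≡q) 1<q) 1≤y₀ (λ j → 1≤u (suc j) (s≤s z≤n))
    (λ j → y-rec (suc j) (s≤s z≤n))
    (λ j → trans (cong x (ℕ.+-comm 1 (suc j))) (x-rec (suc j) (s≤s z≤n)))
  cauchy : Cauchy (partialSum (p / q) x)
  cauchy = subst (λ r → Cauchy (partialSum r x)) (sym p/q≡convergent) S-cauchy
  index : ∀ N j → N + 3 * suc j ≡ 3 + (j * 3 + N)
  index = ℕ-solve-∀
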